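{- Let $\mathcal W$ be a category with terminal object $\top$. Any $\top$-slice right adjoint multiplier $-\ltimes U:\mathcal W\to\mathcal W$ and any presheaf $\Xi\in\mathrm{Psh}(\mathcal W)$ give rise to a quadruple of adjoint functors $$\exists^{\Xi}_{\mathbf yU}\dashv\mathsf F^{\Xi}_{\mathbf yU}\dashv\forall^{\Xi}_{\mathbf yU}\dashv\mathsf T^{\Xi}_{\mathbf yU},$$ $$\exists^{\Xi}_{\mathbf yU},\ \forall^{\Xi}_{\mathbf yU}:\mathrm{Psh}(\mathcal W/(\Xi\ltimes\mathbf yU))\to\mathrm{Psh}(\mathcal W/\Xi),\qquad \mathsf F^{\Xi}_{\mathbf yU},\ \mathsf T^{\Xi}_{\mathbf yU}:\mathrm{Psh}(\mathcal W/\Xi)\to\mathrm{Psh}(\mathcal W/(\Xi\ltimes\mathbf yU)).$$ (Without $\top$-slice right adjointness, one loses the leftmost adjoint functor $\exists^{\Xi}_{\mathbf yU}$ and the leftmost adjoint modality $\mathsf f_u$ below.) If $\Xi=[\![X]\!]$ is the interpretation of a shape context $X$ (and $U$ is the object associated with a shape $\mathbb U$), the latter three functors can be internalized as adjoint modalities $\mathsf f_u\dashv\forall_u\dashv\mathsf t_u$, with an additional left name $\exists_u$ for (the left adjoint of) $\mathsf f_u$, where $\mathsf f_u,\mathsf t_u:X\to(X,u:\mathbb U)$ and $\forall_u:(X,u:\mathbb U)\to X$, such that $$[\![\mathrm{lock}(\mathsf f_u)]\!]=\exists^{\Xi}_{\mathbf yU},\qquad [\![\mathsf f_u]\!]=[\![\mathrm{lock}(\forall_u)]\!]=\mathsf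 F^{\Xi}_{\mathbf yU},\qquad [\![\forall_u]\!]=[\![\mathrm{lock}(\mathsf t_u)]\!]=\forall^{\Xi}_{\mathbf yU},\qquad [\![\mathsf t_u]\!]=\mathsf T^{\Xi}_{\mathbf yU}.$$ The units and co-units are denoted (all with sub- and superscripts $\mathbf yU$, $\Xi$, omitted here) $$\mathsf{copy}:\mathrm{id}\to\mathsf F\circ\exists,\quad \mathsf{drop}:\exists\circ\mathsf F\to\mathrm{id},\quad \mathsf{const}:\mathrm{id}\to\forall\circ\mathsf F,\quad \mathsf{app}:\mathsf F\circ\forall\to\mathrm{id},\quad \mathsf{reidx}:\mathrm{id}\to\mathsf T\circ\forall,\quad \mathsf{unmerid}:\forall\circ\mathsf T\to\mathrm{id},$$ and the corresponding 2-cells between modalities are denoted $\mathsf{const}_u:\mathrm{id}\Rightarrow\forall_u\circ\mathsf f_u$ (with left name $\mathsf{drop}_u$), $\mathsf{app}_u:\mathsf f_u\circ\forall_u\Rightarrow\mathrm{id}$ (with left name $\mathsf{copy}_u$), $\mathsf{reidx}_u:\mathrm{id}\Rightarrow\mathsf t_u\circ\forall_u$ (with left name $\mathsf{app}_u$) and $\mathsf{unmerid}_u:\forall_u\circ\mathsf t_u\Rightarrow\mathrm{id}$ (with left name $\mathsf{const}_u$). Here $\mathsf{reidx}$ stands for "reindex" and $\mathsf{unmerid}$ is the negation of $\mathsf{merid}$, which stands for "meridian".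
   Context: A multiplier for $U\in\mathcal W$ is an endofunctor $-\ltimes U:\mathcal W\to\mathcal W$ with $\top\ltimes U\cong U$; it has a natural second projection $\pi_2:W\ltimes U\to\top\ltimes U\cong U$. The fresh weakening functor is $\mathsf F_U:\mathcal W\to\mathcal W/U$, $W\mapsto(W\ltimes U,\pi_2)$. The multiplier is $\top$-slice right adjoint if $\mathsf F_U$ has a left adjoint $\exists_U:\mathcal W/U\to\mathcal W$. $\mathbf y$ is the Yoneda embedding, $-\ltimes\mathbf yU:\mathrm{Psh}(\mathcal W)\to\mathrm{Psh}(\mathcal W)$ is the left Kan extension of $-\ltimes U$ (so $\mathbf yW\ltimes\mathbf yU\cong\mathbf y(W\ltimes U)$), and $\mathcal W/\Xi$ is the category of elements of $\Xi$. For a presheaf $\Xi$, $\mathsf F_U^{/\Xi}:\mathcal W/\Xi\to\mathcal W/(\Xi\ltimes\mathbf yU)$ is $(W,\xi)\mapsto(W\ltimes U,\xi\ltimes\mathbf yU)$, where $\xi\ltimes\mathbf yU$ is the $(W\ltimes U)$-shaped cell of $\Xi\ltimes\mathbf yU$ obtained from $\xi:\mathbf yW\to\Xi$. For a $\top$-slice right adjoint multiplier, each $\mathsf F_U^{/\Xi}$ has a left adjoint $\exists_U^{/\Xi}$. Meaning of the notation for the four functors (up to natural isomorphism): $\exists^\Xi_{\mathbf yU}$ is left Kan extension along $\exists_U^{/\Xi}$; $\mathsf F^\Xi_{\mathbf yU}$ is precomposition with $\exists_U^{/\Xi}$, equivalently left Kan extension along $\mathsf F_U^{/\Xi}$; $\forall^\Xi_{\mathbf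 yU}$ is right Kan extension along $\exists_U^{/\Xi}$, equivalently precomposition with $\mathsf F_U^{/\Xi}$; $\mathsf T^\Xi_{\mathbf yU}$ is right Kan extension along $\mathsf F_U^{/\Xi}$. Shape contexts and mode theory: to each shape $\mathbb U$ is associated a multiplier $-\ltimes U$ on $\mathcal W$; shape contexts are lists of shape variables, interpreted by $[\![\cdot]\!]=\top$ and $[\![X,u:\mathbb U]\!]=[\![X]\!]\ltimes\mathbf yU$. Modes are shape contexts, $X$ being modelled by $\mathrm{Psh}(\mathcal W/[\![X]\!])$. A modality $\mu:X_1\to X_2$ is by definition a functor $[\![\mathrm{lock}(\mu)]\!]:\mathrm{Psh}(\mathcal W/[\![X_2]\!])\to\mathrm{Psh}(\mathcal W/[\![X_1]\!])$ (its lock functor) having a right adjoint $[\![\mu]\!]:\mathrm{Psh}(\mathcal W/[\![X_1]\!])\to\mathrm{Psh}(\mathcal W/[\![X_2]\!])$. The lock functor of $\nu\circ\mu$ is $[\![\mathrm{lock}(\mu)]\!]\circ[\![\mathrm{lock}(\nu)]\!]$. A 2-cell $\mu\Rightarrow\nu$ is a natural transformation $[\![\mathrm{lock}(\nu)]\!]\to[\![\mathrm{lock}(\mu)]\!]$, which induces a natural transformation $[\![\mu]\!]\to[\![\nu]\!]$. A left name of a modality or 2-cell is a name for its underlying lock functor, respectively for the underlying natural transformation between lock functors. -}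

module Defs where

open import Level using (Level; _⊔_) renaming (suc to lsuc)
open import Data.Product using (Σ; Σ-syntax; _,_; _×_; proj₁; proj₂)
open import Data.Unit.Polymorphic using (⊤; tt)
open import Function.Bundles using (Func)
import Function.Construct.Identity as Identity
import Function.Construct.Composition as Composition
import Function.Relation.Binary.Setoid.Equality as FuncEq
open import Relation.Binary.Bundles using (Setoid)
open import Relation.Binary.Core using (Rel)
open import Relation.Binary.Structures using (IsEquivalence)
open import Relation.Binary.PropositionalEquality using (_≡_)
open import Relation.Binary.Construct.Closure.Equivalence as Eq using (EqClosure)
import Relation.Binary.Construct.On as On
import Relation.Binary.Construct.Always as Always
import Relation.Binary.Reasoning.Setoid as SetoidReasoning

-- Categories have setoids of morphisms; there is no equality of objects.
--
-- The structures below have no η and inlined constructors, so that a functor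
-- defined by a record expression unfolds only under a projection; otherwise
-- conversion checking would compare the proofs of the functor laws.

record Category (o ℓ e : Level) : Set (lsuc (o ⊔ ℓ ⊔ e)) where
  no-eta-equality
  constructor mkCategory
  infix  4 _⇒_ _≈_
  infixr 9 _∘_
  field
    Obj       : Set o
    _⇒_       : Obj → Obj → Set ℓ
    _≈_       : ∀ {A B} → Rel (A ⇒ B) e
    id        : ∀ {A} → A ⇒ A
    _∘_       : ∀ {A B C} → B ⇒ C → A ⇒ B → A ⇒ C
    assoc     : ∀ {A B C D} {f : A ⇒ B} {g : B ⇒ C} {h : C ⇒ D} →
                (h ∘ g) ∘ f ≈ h ∘ (g ∘ f)
    identityˡ : ∀ {A B} {f : A ⇒ B} → id ∘ f ≈ f
    identityʳ : ∀ {A B} {f : A ⇒ B} → f ∘ id ≈ f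
    equiv     : ∀ {A B} → IsEquivalence (_≈_ {A} {B})
    ∘-resp-≈  : ∀ {A B C} {f h : B ⇒ C} {g i : A ⇒ B} →
                f ≈ h → g ≈ i → f ∘ g ≈ h ∘ i

  module Equiv {A B : Obj} = IsEquivalence (equiv {A} {B})

  hom-setoid : Obj → Obj → Setoid ℓ e
  hom-setoid A B = record { isEquivalence = equiv {A} {B} }

  module HomReasoning {A B : Obj} = SetoidReasoning (hom-setoid A B)

  ∘-resp-≈ˡ : ∀ {A B C} {f h : B ⇒ C} {g : A ⇒ B} → f ≈ h → f ∘ g ≈ h ∘ g
  ∘-resp-≈ˡ p = ∘-resp-≈ p Equiv.refl

  ∘-resp-≈ʳ : ∀ {A B C} {f : B ⇒ C} {g h : A ⇒ B} → g ≈ h → f ∘ g ≈ f ∘ h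
  ∘-resp-≈ʳ p = ∘-resp-≈ Equiv.refl p

{-# INLINE mkCategory #-}

private
  variable
    o ℓ e o′ ℓ′ e′ o″ ℓ″ e″ o‴ ℓ‴ e‴ s : Level

_ᵒᵖ : Category o ℓ e → Category o ℓ e
C ᵒᵖ = record
  { Obj = Obj ; _⇒_ = λ A B → B ⇒ A ; _≈_ = _≈_ ; id = id ; _∘_ = λ f g → g ∘ f
  ; assoc = Equiv.sym assoc ; identityˡ = identityʳ ; identityʳ = identityˡ
  ; equiv = equiv ; ∘-resp-≈ = λ p q → ∘-resp-≈ q p
  } where open Category C

record Iso (C : Category o ℓ e) (A B : Category.Obj C) : Set (ℓ ⊔ e) where
  open Category C
  field
    to   : A ⇒ B
    from : B ⇒ A
    isoˡ : from ∘ to ≈ id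
    isoʳ : to ∘ from ≈ id

record Terminal (C : Category o ℓ e) : Set (o ⊔ ℓ ⊔ e) where
  open Category C
  field
    top      : Obj
    !        : ∀ {A} → A ⇒ top
    !-unique : ∀ {A} (f : A ⇒ top) → ! ≈ f

record Functor (C : Category o ℓ e) (D : Category o′ ℓ′ e′)
       : Set (o ⊔ ℓ ⊔ e ⊔ o′ ⊔ ℓ′ ⊔ e′) where
  no-eta-equality
  constructor mkFunctor
  private
    module C = Category C
    module D = Category D
  field
    F₀           : C.Obj → D.Obj
    F₁           : ∀ {A B} → A C.⇒ B → F₀ A D.⇒ F₀ B
    identity     : ∀ {A} → F₁ (C.id {A}) D.≈ D.id
    homomorphism : ∀ {X Y Z} {f : X C.⇒ Y} {g : Y C.⇒ Z} →
                   F₁ (g C.∘ f) D.≈ F₁ g D.∘ F₁ f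
    F-resp-≈     : ∀ {A B} {f g : A C.⇒ B} → f C.≈ g → F₁ f D.≈ F₁ g

{-# INLINE mkFunctor #-}

open Functor using (F₀; F₁)

idF : {C : Category o ℓ e} → Functor C C
idF {C = C} = record
  { F₀ = λ A → A ; F₁ = λ f → f ; identity = Equiv.refl
  ; homomorphism = Equiv.refl ; F-resp-≈ = λ p → p }
  where open Category C

infixr 9 _∘F_

_∘F_ : {C : Category o ℓ e} {D : Category o′ ℓ′ e′} {E : Category o″ ℓ″ e″} →
       Functor D E → Functor C D → Functor C E
_∘F_ {E = E} G F = record
  { F₀ = λ A → G.F₀ (F.F₀ A)
  ; F₁ = λ f → G.F₁ (F.F₁ f)
  ; identity = trans (G.F-resp-≈ F.identity) G.identity
  ; homomorphism = trans (G.F-resp-≈ F.homomorphism) G.homomorphism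
  ; F-resp-≈ = λ p → G.F-resp-≈ (F.F-resp-≈ p)
  } where
  module F = Functor F
  module G = Functor G
  open Category.Equiv E

opF : {C : Category o ℓ e} {D : Category o′ ℓ′ e′} →
      Functor C D → Functor (C ᵒᵖ) (D ᵒᵖ)
opF F = record
  { F₀ = F.F₀ ; F₁ = F.F₁ ; identity = F.identity
  ; homomorphism = F.homomorphism ; F-resp-≈ = F.F-resp-≈ }
  where module F = Functor F

record NatTrans {C : Category o ℓ e} {D : Category o′ ℓ′ e′} (F G : Functor C D)
       : Set (o ⊔ ℓ ⊔ ℓ′ ⊔ e′) where
  no-eta-equality
  constructor mkNatTrans
  private
    module C = Category C
    module F = Functor F
    module G = Functor G
  open Category D
  field
    η       : ∀ X → F.F₀ X ⇒ G.F₀ X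
    natural : ∀ {X Y} (f : X C.⇒ Y) → η Y ∘ F.F₁ f ≈ G.F₁ f ∘ η X

{-# INLINE mkNatTrans #-}

open NatTrans using (η)

Functors : Category o ℓ e → Category o′ ℓ′ e′ →
           Category (o ⊔ ℓ ⊔ e ⊔ o′ ⊔ ℓ′ ⊔ e′) (o ⊔ ℓ ⊔ ℓ′ ⊔ e′) (o ⊔ e′)
Functors C D = record
  { Obj = Functor C D
  ; _⇒_ = NatTrans
  ; _≈_ = λ α β → ∀ X → η α X ≈ η β X
  ; id = λ {F} → record
    { η = λ _ → id ; natural = λ _ → trans identityˡ (sym identityʳ) }
  ; _∘_ = λ {F} {G} {H} β α → record
    { η = λ X → η β X ∘ η α X
    ; natural = λ f → trans assoc (trans (∘-resp-≈ʳ (NatTrans.natural α f))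
        (trans (sym assoc) (trans (∘-resp-≈ˡ (NatTrans.natural β f)) assoc)))
    }
  ; assoc = λ _ → assoc
  ; identityˡ = λ _ → identityˡ
  ; identityʳ = λ _ → identityʳ
  ; equiv = record
    { refl = λ _ → refl ; sym = λ p X → sym (p X) ; trans = λ p q X → trans (p X) (q X) }
  ; ∘-resp-≈ = λ p q X → ∘-resp-≈ (p X) (q X)
  } where
  open Category D
  open Equiv

module _ {C : Category o ℓ e} {D : Category o′ ℓ′ e′} where

  infix 4 _≃_ _≅_

  _≃_ : {F G : Functor C D} → Rel (NatTrans F G) (o ⊔ e′)
  _≃_ = Category._≈_ (Functors C D)

  _≅_ : Functor C D → Functor C D → Set (o ⊔ ℓ ⊔ ℓ′ ⊔ e′)
  _≅_ = Iso (Functors C D)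

module _ {C : Category o ℓ e} {D : Category o′ ℓ′ e′} where
  open Category D
  open Equiv

  λ→ : {F : Functor C D} → NatTrans (idF ∘F F) F
  λ→ = record { η = λ _ → id ; natural = λ _ → trans identityˡ (sym identityʳ) }

  λ← : {F : Functor C D} → NatTrans F (idF ∘F F)
  λ← = record { η = λ _ → id ; natural = λ _ → trans identityˡ (sym identityʳ) }

  ρ→ : {F : Functor C D} → NatTrans (F ∘F idF) F
  ρ→ = record { η = λ _ → id ; natural = λ _ → trans identityˡ (sym identityʳ) }

  ρ← : {F : Functor C D} → NatTrans F (F ∘F idF)
  ρ← = record { η = λ _ → id ; natural = λ _ → trans identityˡ (sym identityʳ) }

module _ {B : Category o ℓ e} {C : Category o′ ℓ′ e′}
         {D : Category o″ ℓ″ e″} {E : Category o‴ ℓ‴ e‴}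
         {H : Functor D E} {G : Functor C D} {F : Functor B C} where
  open Category E
  open Equiv

  α→ : NatTrans ((H ∘F G) ∘F F) (H ∘F (G ∘F F))
  α→ = record { η = λ _ → id ; natural = λ _ → trans identityˡ (sym identityʳ) }

  α← : NatTrans (H ∘F (G ∘F F)) ((H ∘F G) ∘F F)
  α← = record { η = λ _ → id ; natural = λ _ → trans identityˡ (sym identityʳ) }

infixr 9 _◂_
infixl 9 _▸_

_◂_ : {C : Category o ℓ e} {D : Category o′ ℓ′ e′} {E : Category o″ ℓ″ e″}
      {F G : Functor C D} (H : Functor D E) → NatTrans F G → NatTrans (H ∘F F) (H ∘F G)
_◂_ {E = E} H β = record
  { η = λ X → H.F₁ (η β X)
  ; natural = λ f → trans (sym H.homomorphism)
      (trans (H.F-resp-≈ (NatTrans.natural β f)) H.homomorphism)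
  } where
  module H = Functor H
  open Category.Equiv E

_▸_ : {C : Category o ℓ e} {D : Category o′ ℓ′ e′} {E : Category o″ ℓ″ e″}
      {F G : Functor D E} → NatTrans F G → (H : Functor C D) → NatTrans (F ∘F H) (G ∘F H)
β ▸ H = record
  { η = λ X → η β (F₀ H X)
  ; natural = λ f → NatTrans.natural β (F₁ H f)
  }

infix 4 _⊣_

record _⊣_ {C : Category o ℓ e} {D : Category o′ ℓ′ e′}
           (L : Functor C D) (R : Functor D C)
       : Set (o ⊔ ℓ ⊔ e ⊔ o′ ⊔ ℓ′ ⊔ e′) where
  no-eta-equality
  constructor mkAdjunction
  private
    module C = Category C
    module D = Category D
  field
    unit   : NatTrans idF (R ∘F L)
    counit : NatTrans (L ∘F R) idF
    zig    : ∀ A → η counit (F₀ L A) D.∘ F₁ L (η unit A) D.≈ D.id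
    zag    : ∀ B → F₁ R (η counit B) C.∘ η unit (F₀ R B) C.≈ C.id

{-# INLINE mkAdjunction #-}

open _⊣_ using (unit; counit)

-- For L ⊣ R and L′ ⊣ R′, the composite R → R′ ∘ L′ ∘ R → R′ ∘ L ∘ R → R′.
mate : {C : Category o ℓ e} {D : Category o′ ℓ′ e′}
       {L L′ : Functor C D} {R R′ : Functor D C} →
       L ⊣ R → L′ ⊣ R′ → NatTrans L′ L → NatTrans R R′
mate {C = C} {D = D} {R = R} {R′ = R′} a a′ β =
  ρ→ ∘ (R′ ◂ counit a) ∘ (R′ ◂ (β ▸ R)) ∘ α→ ∘ (unit a′ ▸ R) ∘ λ←
  where open Category (Functors D C)

id⊣id : {C : Category o ℓ e} → idF {C = C} ⊣ idF
id⊣id {C = C} = record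
  { unit = λ← ; counit = λ→ ; zig = λ _ → identityˡ ; zag = λ _ → identityˡ }
  where open Category C

_∘⊣_ : {C : Category o ℓ e} {D : Category o′ ℓ′ e′} {E : Category o″ ℓ″ e″}
       {L : Functor C D} {R : Functor D C} {L′ : Functor D E} {R′ : Functor E D} →
       L′ ⊣ R′ → L ⊣ R → L′ ∘F L ⊣ R ∘F R′
_∘⊣_ {C = C} {D} {E} {L} {R} {L′} {R′} b a = record
  { unit = record
    { η = λ A → R.F₁ (η (unit b) (L.F₀ A)) C.∘ η (unit a) A
    ; natural = λ {X} {Y} f → let open C in let open C.HomReasoning in begin
        (R.F₁ (η (unit b) (L.F₀ Y)) ∘ η (unit a) Y) ∘ f
          ≈⟨ assoc ⟩
        R.F₁ (η (unit b) (L.F₀ Y)) ∘ η (unit a) Y ∘ f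
          ≈⟨ ∘-resp-≈ʳ (NatTrans.natural (unit a) f) ⟩
        R.F₁ (η (unit b) (L.F₀ Y)) ∘ R.F₁ (L.F₁ f) ∘ η (unit a) X
          ≈⟨ assoc ⟨
        (R.F₁ (η (unit b) (L.F₀ Y)) ∘ R.F₁ (L.F₁ f)) ∘ η (unit a) X
          ≈⟨ ∘-resp-≈ˡ R.homomorphism ⟨
        R.F₁ (η (unit b) (L.F₀ Y) D.∘ L.F₁ f) ∘ η (unit a) X
          ≈⟨ ∘-resp-≈ˡ (R.F-resp-≈ (NatTrans.natural (unit b) (L.F₁ f))) ⟩
        R.F₁ (R′.F₁ (L′.F₁ (L.F₁ f)) D.∘ η (unit b) (L.F₀ X)) ∘ η (unit a) X
          ≈⟨ ∘-resp-≈ˡ R.homomorphism ⟩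
        (R.F₁ (R′.F₁ (L′.F₁ (L.F₁ f))) ∘ R.F₁ (η (unit b) (L.F₀ X))) ∘ η (unit a) X
          ≈⟨ assoc ⟩
        R.F₁ (R′.F₁ (L′.F₁ (L.F₁ f))) ∘ R.F₁ (η (unit b) (L.F₀ X)) ∘ η (unit a) X ∎
    }
  ; counit = record
    { η = λ B → η (counit b) B E.∘ L′.F₁ (η (counit a) (R′.F₀ B))
    ; natural = λ {X} {Y} f → let open E in let open E.HomReasoning in begin
        (η (counit b) Y ∘ L′.F₁ (η (counit a) (R′.F₀ Y))) ∘ L′.F₁ (L.F₁ (R.F₁ (R′.F₁ f)))
          ≈⟨ assoc ⟩
        η (counit b) Y ∘ L′.F₁ (η (counit a) (R′.F₀ Y)) ∘ L′.F₁ (L.F₁ (R.F₁ (R′.F₁ f)))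
          ≈⟨ ∘-resp-≈ʳ L′.homomorphism ⟨
        η (counit b) Y ∘ L′.F₁ (η (counit a) (R′.F₀ Y) D.∘ L.F₁ (R.F₁ (R′.F₁ f)))
          ≈⟨ ∘-resp-≈ʳ (L′.F-resp-≈ (NatTrans.natural (counit a) (R′.F₁ f))) ⟩
        η (counit b) Y ∘ L′.F₁ (R′.F₁ f D.∘ η (counit a) (R′.F₀ X))
          ≈⟨ ∘-resp-≈ʳ L′.homomorphism ⟩
        η (counit b) Y ∘ L′.F₁ (R′.F₁ f) ∘ L′.F₁ (η (counit a) (R′.F₀ X))
          ≈⟨ assoc ⟨
        (η (counit b) Y ∘ L′.F₁ (R′.F₁ f)) ∘ L′.F₁ (η (counit a) (R′.F₀ X))
          ≈⟨ ∘-resp-≈ˡ (NatTrans.natural (counit b) f) ⟩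
        (f ∘ η (counit b) X) ∘ L′.F₁ (η (counit a) (R′.F₀ X))
          ≈⟨ assoc ⟩
        f ∘ η (counit b) X ∘ L′.F₁ (η (counit a) (R′.F₀ X)) ∎
    }
  ; zig = λ A → let open E in let open E.HomReasoning in begin
      (η (counit b) (L′.F₀ (L.F₀ A)) ∘ L′.F₁ (η (counit a) (R′.F₀ (L′.F₀ (L.F₀ A)))))
        ∘ L′.F₁ (L.F₁ (R.F₁ (η (unit b) (L.F₀ A)) C.∘ η (unit a) A))
        ≈⟨ assoc ⟩
      η (counit b) (L′.F₀ (L.F₀ A)) ∘ L′.F₁ (η (counit a) (R′.F₀ (L′.F₀ (L.F₀ A))))
        ∘ L′.F₁ (L.F₁ (R.F₁ (η (unit b) (L.F₀ A)) C.∘ η (unit a) A))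
        ≈⟨ ∘-resp-≈ʳ L′.homomorphism ⟨
      η (counit b) (L′.F₀ (L.F₀ A))
        ∘ L′.F₁ (η (counit a) (R′.F₀ (L′.F₀ (L.F₀ A)))
                 D.∘ L.F₁ (R.F₁ (η (unit b) (L.F₀ A)) C.∘ η (unit a) A))
        ≈⟨ ∘-resp-≈ʳ (L′.F-resp-≈ (zig-inner A)) ⟩
      η (counit b) (L′.F₀ (L.F₀ A)) ∘ L′.F₁ (η (unit b) (L.F₀ A))
        ≈⟨ b.zig (L.F₀ A) ⟩
      id ∎
  ; zag = λ B → let open C in let open C.HomReasoning in begin
      R.F₁ (R′.F₁ (η (counit b) B E.∘ L′.F₁ (η (counit a) (R′.F₀ B))))
        ∘ R.F₁ (η (unit b) (L.F₀ (R.F₀ (R′.F₀ B)))) ∘ η (unit a) (R.F₀ (R′.F₀ B))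
        ≈⟨ assoc ⟨
      (R.F₁ (R′.F₁ (η (counit b) B E.∘ L′.F₁ (η (counit a) (R′.F₀ B))))
        ∘ R.F₁ (η (unit b) (L.F₀ (R.F₀ (R′.F₀ B))))) ∘ η (unit a) (R.F₀ (R′.F₀ B))
        ≈⟨ ∘-resp-≈ˡ R.homomorphism ⟨
      R.F₁ (R′.F₁ (η (counit b) B E.∘ L′.F₁ (η (counit a) (R′.F₀ B)))
            D.∘ η (unit b) (L.F₀ (R.F₀ (R′.F₀ B)))) ∘ η (unit a) (R.F₀ (R′.F₀ B))
        ≈⟨ ∘-resp-≈ˡ (R.F-resp-≈ (zag-inner B)) ⟩
      R.F₁ (η (counit a) (R′.F₀ B)) ∘ η (unit a) (R.F₀ (R′.F₀ B))
        ≈⟨ a.zag (R′.F₀ B) ⟩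
      id ∎
  } where
  module C = Category C
  module D = Category D
  module E = Category E
  module L = Functor L
  module R = Functor R
  module L′ = Functor L′
  module R′ = Functor R′
  module a = _⊣_ a
  module b = _⊣_ b

  zig-inner : ∀ A → η (counit a) (R′.F₀ (L′.F₀ (L.F₀ A)))
                    D.∘ L.F₁ (R.F₁ (η (unit b) (L.F₀ A)) C.∘ η (unit a) A)
                    D.≈ η (unit b) (L.F₀ A)
  zig-inner A = let open D in let open D.HomReasoning in begin
    η (counit a) (R′.F₀ (L′.F₀ (L.F₀ A))) ∘ L.F₁ (R.F₁ (η (unit b) (L.F₀ A)) C.∘ η (unit a) A)
      ≈⟨ ∘-resp-≈ʳ L.homomorphism ⟩
    η (counit a) (R′.F₀ (L′.F₀ (L.F₀ A))) ∘ L.F₁ (R.F₁ (η (unit b) (L.F₀ A))) ∘ L.F₁ (η (unit a) A)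
      ≈⟨ assoc ⟨
    (η (counit a) (R′.F₀ (L′.F₀ (L.F₀ A))) ∘ L.F₁ (R.F₁ (η (unit b) (L.F₀ A)))) ∘ L.F₁ (η (unit a) A)
      ≈⟨ ∘-resp-≈ˡ (NatTrans.natural (counit a) (η (unit b) (L.F₀ A))) ⟩
    (η (unit b) (L.F₀ A) ∘ η (counit a) (L.F₀ A)) ∘ L.F₁ (η (unit a) A)
      ≈⟨ assoc ⟩
    η (unit b) (L.F₀ A) ∘ η (counit a) (L.F₀ A) ∘ L.F₁ (η (unit a) A)
      ≈⟨ ∘-resp-≈ʳ (a.zig A) ⟩
    η (unit b) (L.F₀ A) ∘ id
      ≈⟨ identityʳ ⟩
    η (unit b) (L.F₀ A) ∎

  zag-inner : ∀ B → R′.F₁ (η (counit b) B E.∘ L′.F₁ (η (counit a) (R′.F₀ B)))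
                    D.∘ η (unit b) (L.F₀ (R.F₀ (R′.F₀ B)))
                    D.≈ η (counit a) (R′.F₀ B)
  zag-inner B = let open D in let open D.HomReasoning in begin
    R′.F₁ (η (counit b) B E.∘ L′.F₁ (η (counit a) (R′.F₀ B))) ∘ η (unit b) (L.F₀ (R.F₀ (R′.F₀ B)))
      ≈⟨ ∘-resp-≈ˡ R′.homomorphism ⟩
    (R′.F₁ (η (counit b) B) ∘ R′.F₁ (L′.F₁ (η (counit a) (R′.F₀ B)))) ∘ η (unit b) (L.F₀ (R.F₀ (R′.F₀ B)))
      ≈⟨ assoc ⟩
    R′.F₁ (η (counit b) B) ∘ R′.F₁ (L′.F₁ (η (counit a) (R′.F₀ B))) ∘ η (unit b) (L.F₀ (R.F₀ (R′.F₀ B)))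
      ≈⟨ ∘-resp-≈ʳ (NatTrans.natural (unit b) (η (counit a) (R′.F₀ B))) ⟨
    R′.F₁ (η (counit b) B) ∘ η (unit b) (R′.F₀ B) ∘ η (counit a) (R′.F₀ B)
      ≈⟨ assoc ⟨
    (R′.F₁ (η (counit b) B) ∘ η (unit b) (R′.F₀ B)) ∘ η (counit a) (R′.F₀ B)
      ≈⟨ ∘-resp-≈ˡ (b.zag B) ⟩
    id ∘ η (counit a) (R′.F₀ B)
      ≈⟨ identityˡ ⟩
    η (counit a) (R′.F₀ B) ∎

-- Presheaves take values in setoids, so that coends exist as quotients.

Setoids : ∀ ℓ → Category (lsuc ℓ) ℓ ℓ
Setoids ℓ = record
  { Obj = Setoid ℓ ℓ
  ; _⇒_ = Func
  ; _≈_ = λ {A} {B} → FuncEq._≈_ A B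
  ; id = λ {A} → Identity.function A
  ; _∘_ = λ g f → Composition.function f g
  ; assoc = λ {D = D} _ → Setoid.refl D
  ; identityˡ = λ {B = B} _ → Setoid.refl B
  ; identityʳ = λ {B = B} _ → Setoid.refl B
  ; equiv = λ {A} {B} → FuncEq.isEquivalence A B
  ; ∘-resp-≈ = λ {C = C} {h = h} p q x → Setoid.trans C (p _) (Func.cong h (q x))
  }

Presheaf : Category ℓ ℓ ℓ → Set (lsuc ℓ)
Presheaf {ℓ} C = Functor (C ᵒᵖ) (Setoids ℓ)

Psh : Category ℓ ℓ ℓ → Category (lsuc ℓ) ℓ ℓ
Psh {ℓ} C = Functors (C ᵒᵖ) (Setoids ℓ)

module Presheaf {C : Category ℓ ℓ ℓ} (P : Presheaf C) where
  private module C = Category C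
  open Functor P using (homomorphism; identity; F-resp-≈)

  infixl 9 _·_

  Elt : C.Obj → Set ℓ
  Elt A = Setoid.Carrier (F₀ P A)

  module At {A : C.Obj} = Setoid (F₀ P A)

  _·_ : ∀ {A B} → Elt B → A C.⇒ B → Elt A
  x · f = Func.to (F₁ P f) x

  ·-congˡ : ∀ {A B} {x y : Elt B} {f : A C.⇒ B} → x At.≈ y → x · f At.≈ y · f
  ·-congˡ {f = f} = Func.cong (F₁ P f)

  ·-congʳ : ∀ {A B} {x : Elt B} {f g : A C.⇒ B} → f C.≈ g → x · f At.≈ x · g
  ·-congʳ {x = x} p = F-resp-≈ p x

  ·-id : ∀ {A} {x : Elt A} → x · C.id At.≈ x
  ·-id {x = x} = identity x

  ·-∘ : ∀ {A B D} {x : Elt D} {g : B C.⇒ D} {f : A C.⇒ B} →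
        x · (g C.∘ f) At.≈ x · g · f
  ·-∘ {x = x} = homomorphism x

⊤ᴾ : {C : Category ℓ ℓ ℓ} → Presheaf C
⊤ᴾ {ℓ} = record
  { F₀ = λ _ → Always.setoid (⊤ {ℓ}) ℓ
  ; F₁ = λ _ → record { to = λ _ → tt ; cong = λ _ → tt }
  ; identity = λ _ → tt ; homomorphism = λ _ → tt ; F-resp-≈ = λ _ _ → tt }

yoneda : (C : Category ℓ ℓ ℓ) → Functor C (Psh C)
yoneda C = record
  { F₀ = λ B → record
    { F₀ = λ A → hom-setoid A B
    ; F₁ = λ f → record { to = λ g → g ∘ f ; cong = ∘-resp-≈ˡ }
    ; identity = λ _ → identityʳ
    ; homomorphism = λ _ → sym assoc
    ; F-resp-≈ = λ p _ → ∘-resp-≈ʳ p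
    }
  ; F₁ = λ f → record
    { η = λ A → record { to = λ g → f ∘ g ; cong = ∘-resp-≈ʳ }
    ; natural = λ _ _ → sym assoc
    }
  ; identity = λ _ _ → identityˡ
  ; homomorphism = λ _ _ → assoc
  ; F-resp-≈ = λ p _ _ → ∘-resp-≈ˡ p
  } where
  open Category C
  open Equiv

∫ : {C : Category ℓ ℓ ℓ} → Presheaf C → Category ℓ ℓ ℓ
∫ {C = C} P = record
  { Obj = Σ[ A ∈ Obj ] Elt A
  ; _⇒_ = λ (A , x) (B , y) → Σ[ f ∈ A ⇒ B ] y · f At.≈ x
  ; _≈_ = λ f g → proj₁ f ≈ proj₁ g
  ; id = id , ·-id
  ; _∘_ = λ (g , q) (f , p) → g ∘ f , At.trans ·-∘ (At.trans (·-congˡ q) p)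
  ; assoc = assoc
  ; identityˡ = identityˡ
  ; identityʳ = identityʳ
  ; equiv = On.isEquivalence proj₁ equiv
  ; ∘-resp-≈ = ∘-resp-≈
  } where
  open Category C
  open Presheaf P

Slice : (C : Category o ℓ e) → Category.Obj C → Category (o ⊔ ℓ) (ℓ ⊔ e) e
Slice C U = record
  { Obj = Σ[ A ∈ Obj ] A ⇒ U
  ; _⇒_ = λ (A , a) (B , b) → Σ[ f ∈ A ⇒ B ] b ∘ f ≈ a
  ; _≈_ = λ f g → proj₁ f ≈ proj₁ g
  ; id = id , identityʳ
  ; _∘_ = λ (g , q) (f , p) → g ∘ f , trans (sym assoc) (trans (∘-resp-≈ˡ q) p)
  ; assoc = assoc
  ; identityˡ = identityˡ
  ; identityʳ = identityʳ
  ; equiv = On.isEquivalence proj₁ equiv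
  ; ∘-resp-≈ = ∘-resp-≈
  } where
  open Category C
  open Equiv

module _ {C D : Category ℓ ℓ ℓ} (K : Functor C D) where
  private
    module C = Category C
    module D = Category D
    module K = Functor K

  precomp : Functor (Psh D) (Psh C)
  precomp = record
    { F₀ = λ P → P ∘F opF K
    ; F₁ = λ α → record { η = λ A → η α (K.F₀ A) ; natural = λ f → NatTrans.natural α (K.F₁ f) }
    ; identity = λ {P} A _ → Setoid.refl (F₀ P (K.F₀ A))
    ; homomorphism = λ {_} {_} {R} A _ → Setoid.refl (F₀ R (K.F₀ A))
    ; F-resp-≈ = λ p A → p (K.F₀ A)
    }

  -- Left Kan extension by the coend (Lan P)(d) = ∫^a D(d , K a) × P a:
  -- the quotient of Σ a, D(d , K a) × P a by (f , x · h) ∼ (K h ∘ f , x).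

  record Cell (P : Presheaf C) (d : D.Obj) : Set ℓ where
    constructor cell
    field
      {base} : C.Obj
      arrow  : d D.⇒ K.F₀ base
      value  : Presheaf.Elt P base

  module _ {P : Presheaf C} where
    open Presheaf P

    data _↝_ {d : D.Obj} : Rel (Cell P d) ℓ where
      slide : ∀ {a b} (h : a C.⇒ b) {f : d D.⇒ K.F₀ a} {g : d D.⇒ K.F₀ b} {x y} →
              K.F₁ h D.∘ f D.≈ g → x At.≈ y · h → cell f x ↝ cell g y

  lan : Presheaf C → Presheaf D
  lan P = record
    { F₀ = λ d → Eq.setoid (_↝_ {P} {d})
    ; F₁ = λ g → record
      { to = restrict g
      ; cong = Eq.gmap (restrict g)
          λ { (slide h p q) → slide h (D.Equiv.trans (D.Equiv.sym D.assoc) (D.∘-resp-≈ˡ p)) q }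
      }
    ; identity = λ _ → reslice D.identityʳ
    ; homomorphism = λ _ → reslice (D.Equiv.sym D.assoc)
    ; F-resp-≈ = λ p _ → reslice (D.∘-resp-≈ʳ p)
    } where
    open Presheaf P

    restrict : ∀ {d d′} → d D.⇒ d′ → Cell P d′ → Cell P d
    restrict g (cell f x) = cell (f D.∘ g) x

    reslice : ∀ {d a} {f g : d D.⇒ K.F₀ a} {x} → f D.≈ g →
              EqClosure (_↝_ {P}) (cell f x) (cell g x)
    reslice p = Eq.return
      (slide C.id (D.Equiv.trans (D.∘-resp-≈ˡ K.identity) (D.Equiv.trans D.identityˡ p))
                  (At.sym ·-id))

  Lan : Functor (Psh C) (Psh D)
  Lan = record
    { F₀ = lan
    ; F₁ = λ {P} {Q} α → record
      { η = λ d → record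
        { to = push α
        ; cong = Eq.gmap (push α) (push-↝ α)
        }
      ; natural = λ _ _ → Eq.reflexive (_↝_ {Q})
      }
    ; identity = λ {P} _ _ → Eq.reflexive (_↝_ {P})
    ; homomorphism = λ {_} {_} {R} _ _ → Eq.reflexive (_↝_ {R})
    ; F-resp-≈ = λ {P} {Q} p d (cell {a} f x) → Eq.return
        (slide C.id (D.Equiv.trans (D.∘-resp-≈ˡ K.identity) D.identityˡ)
          (Presheaf.At.trans Q (p a x) (Presheaf.At.sym Q (Presheaf.·-id Q))))
    } where
    push : ∀ {P Q : Presheaf C} {d} → NatTrans P Q → Cell P d → Cell Q d
    push α (cell {a} f x) = cell f (Func.to (η α a) x)

    push-↝ : ∀ {P Q : Presheaf C} {d} (α : NatTrans P Q) {x y : Cell P d} →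
             x ↝ y → push α x ↝ push α y
    push-↝ {P} {Q} α (slide {a} h p q) =
      slide h p (Presheaf.At.trans Q (Func.cong (η α a) q) (NatTrans.natural α h _))

  -- Right Kan extension by the end (Ran P)(d) = ∫_a P a ^ D(K a , d).

  Ran : Functor (Psh C) (Psh D)
  Ran = record
    { F₀ = λ P → record
      { F₀ = λ d → Category.hom-setoid (Psh C) (nerve d) P
      ; F₁ = λ g → record
        { to = λ α → α ∘ᴾ nerve₁ g
        ; cong = λ {α} {β} p A x → p A (g D.∘ x)
        }
      ; identity = λ α A x → Func.cong (η α A) D.identityˡ
      ; homomorphism = λ α A x → Func.cong (η α A) D.assoc
      ; F-resp-≈ = λ p α A x → Func.cong (η α A) (D.∘-resp-≈ˡ p)
      }
    ; F₁ = λ {P} {Q} β → record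
      { η = λ d → record
        { to = λ α → β ∘ᴾ α
        ; cong = λ p A x → Func.cong (η β A) (p A x)
        }
      ; natural = λ g α A x → Presheaf.At.refl Q
      }
    ; identity = λ {P} _ _ _ _ → Presheaf.At.refl P
    ; homomorphism = λ {_} {_} {R} _ _ _ _ → Presheaf.At.refl R
    ; F-resp-≈ = λ p _ α A x → p A (Func.to (η α A) x)
    } where
    open Category (Psh C) using () renaming (_∘_ to _∘ᴾ_)

    nerve : D.Obj → Presheaf C
    nerve d = F₀ precomp (F₀ (yoneda D) d)

    nerve₁ : ∀ {d d′} → d D.⇒ d′ → NatTrans (nerve d) (nerve d′)
    nerve₁ g = F₁ precomp (F₁ (yoneda D) g)

record Multiplier {W : Category o ℓ e} (T : Terminal W) (U : Category.Obj W)
       : Set (o ⊔ ℓ ⊔ e) where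
  open Terminal T
  field
    [-⋉U] : Functor W W
    ⊤⋉U≅U : Iso W (F₀ [-⋉U] top) U

  open Category W
  open Functor [-⋉U]

  π₂ : ∀ {A} → F₀ [-⋉U] A ⇒ U
  π₂ = Iso.to ⊤⋉U≅U ∘ F₁ [-⋉U] !

  π₂-natural : ∀ {A B} (f : A ⇒ B) → π₂ ∘ F₁ [-⋉U] f ≈ π₂
  π₂-natural f = let open Equiv in
    trans assoc (∘-resp-≈ʳ (trans (sym homomorphism) (F-resp-≈ (sym (!-unique (! ∘ f))))))

  fresh : Functor W (Slice W U)
  fresh = record
    { F₀ = λ A → F₀ [-⋉U] A , π₂
    ; F₁ = λ f → F₁ [-⋉U] f , π₂-natural f
    ; identity = identity
    ; homomorphism = homomorphism
    ; F-resp-≈ = F-resp-≈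
    }

record TopSliceRightAdjoint {W : Category o ℓ e} {T : Terminal W} {U : Category.Obj W}
       (M : Multiplier T U) : Set (o ⊔ ℓ ⊔ e) where
  field
    ∃U : Functor (Slice W U) W
    ∃U⊣fresh : ∃U ⊣ Multiplier.fresh M

module _ {W : Category ℓ ℓ ℓ} {T : Terminal W} {U : Category.Obj W} (M : Multiplier T U) where
  open Category W
  open Multiplier M
  private module K = Functor [-⋉U]

  [-⋉yU] : Functor (Psh W) (Psh W)
  [-⋉yU] = Lan [-⋉U]

  infixl 8 _⋉y

  _⋉y : Presheaf W → Presheaf W
  Ξ ⋉y = F₀ [-⋉yU] Ξ

  module _ (Ξ : Presheaf W) where
    open Presheaf Ξ

    -- For ξ : yA → Ξ this is the image under ξ ⋉ yU of the element of
    -- (yA ⋉ yU)(A ⋉ U) that corresponds to id under yA ⋉ yU ≅ y(A ⋉ U).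
    ⋉cell : ∀ {A} → Elt A → Presheaf.Elt (Ξ ⋉y) (K.F₀ A)
    ⋉cell ξ = cell id ξ

    fresh/ : Functor (∫ Ξ) (∫ (Ξ ⋉y))
    fresh/ = record
      { F₀ = λ (A , ξ) → K.F₀ A , ⋉cell ξ
      ; F₁ = λ (f , p) → K.F₁ f , Eq.symmetric (_↝_ [-⋉U])
          (Eq.return (slide f (Equiv.trans identityʳ (Equiv.sym identityˡ)) (At.sym p)))
      ; identity = K.identity
      ; homomorphism = K.homomorphism
      ; F-resp-≈ = K.F-resp-≈
      }

    Fᴾ Tᴾ : Functor (Psh (∫ Ξ)) (Psh (∫ (Ξ ⋉y)))
    Fᴾ = Lan fresh/
    Tᴾ = Ran fresh/

    ∀ᴾ : Functor (Psh (∫ (Ξ ⋉y))) (Psh (∫ Ξ))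
    ∀ᴾ = precomp fresh/

  module _ (S : TopSliceRightAdjoint M) (Ξ : Presheaf W) where
    open TopSliceRightAdjoint S
    open Presheaf Ξ
    private
      module E = Functor ∃U
      module adj = _⊣_ ∃U⊣fresh

      _≋_ : ∀ {A} → Rel (Presheaf.Elt (Ξ ⋉y) A) ℓ
      _≋_ {A} = Setoid._≈_ (F₀ (Ξ ⋉y) A)

      over : ∀ {A} → Presheaf.Elt (Ξ ⋉y) A → A ⇒ U
      over (cell f ξ) = π₂ ∘ f

      ε : ∀ B → E.F₀ (K.F₀ B , π₂) ⇒ B
      ε = η adj.counit

      -- If u is the composite A → B ⋉ U → U of f and π₂, then f is a morphism
      -- (A , u) → fresh B of the slice over U; pull ξ ∈ Ξ(B) back along its transpose.
      transport : ∀ {A} (u : A ⇒ U) (x : Presheaf.Elt (Ξ ⋉y) A) → over x ≈ u → Elt (E.F₀ (A , u))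
      transport u (cell {B} f ξ) p = ξ · (ε B ∘ E.F₁ (f , p))

      Agree : ∀ {A} → Rel (Presheaf.Elt (Ξ ⋉y) A) ℓ
      Agree x y = over x ≈ over y ×
                  (∀ u p q → transport u x p At.≈ transport u y q)

      agree : ∀ {A} {x y : Presheaf.Elt (Ξ ⋉y) A} → x ≋ y → Agree x y
      agree = Eq.fold
        (record
          { refl = λ {x} → Equiv.refl , λ u p q → ·-congʳ (∘-resp-≈ʳ (E.F-resp-≈ Equiv.refl))
          ; sym = λ (r , s) → Equiv.sym r , λ u p q → At.sym (s u q p)
          ; trans = λ (r , s) (r′ , s′) → Equiv.trans r r′ ,
              λ u p q → At.trans (s u p (Equiv.trans r′ q)) (s′ u (Equiv.trans r′ q) q)
          })
        λ { (slide {a} {b} h {f} {g} {x} {y} p q) →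
            (let open HomReasoning in begin
              π₂ ∘ f              ≈⟨ ∘-resp-≈ˡ (π₂-natural h) ⟨
              (π₂ ∘ K.F₁ h) ∘ f   ≈⟨ assoc ⟩
              π₂ ∘ K.F₁ h ∘ f     ≈⟨ ∘-resp-≈ʳ p ⟩
              π₂ ∘ g              ∎) ,
            λ u r s →
              At.trans (·-congˡ q) (At.trans (At.sym ·-∘) (·-congʳ
                (let open HomReasoning in begin
                  h ∘ ε a ∘ E.F₁ (f , r)
                    ≈⟨ assoc ⟨
                  (h ∘ ε a) ∘ E.F₁ (f , r)
                    ≈⟨ ∘-resp-≈ˡ (NatTrans.natural adj.counit h) ⟨
                  (ε b ∘ E.F₁ (F₁ fresh h)) ∘ E.F₁ (f , r)
                    ≈⟨ assoc ⟩
                  ε b ∘ E.F₁ (F₁ fresh h) ∘ E.F₁ (f , r)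
                    ≈⟨ ∘-resp-≈ʳ E.homomorphism ⟨
                  ε b ∘ E.F₁ (K.F₁ h ∘ f , _)
                    ≈⟨ ∘-resp-≈ʳ (E.F-resp-≈ p) ⟩
                  ε b ∘ E.F₁ (g , s) ∎))) }

      element : ∀ {A} (x : Presheaf.Elt (Ξ ⋉y) A) → Elt (E.F₀ (A , over x))
      element x = transport (over x) x Equiv.refl

      mor : ∀ {A B} {x : Presheaf.Elt (Ξ ⋉y) A} {y : Presheaf.Elt (Ξ ⋉y) B} (f : A ⇒ B) →
            Presheaf._·_ (Ξ ⋉y) y f ≋ x →
            Category._⇒_ (Slice W U) (A , over x) (B , over y)
      mor f p = f , Equiv.trans assoc (proj₁ (agree p))

    ∃/ : Functor (∫ (Ξ ⋉y)) (∫ Ξ)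
    ∃/ = record
      { F₀ = λ (A , x) → E.F₀ (A , over x) , element x
      ; F₁ = λ { {A , x} {B , y} (f , p) → E.F₁ (mor {x = x} {y} f p) ,
          At.trans (At.sym ·-∘)
            (At.trans
              (·-congʳ (Equiv.trans assoc (∘-resp-≈ʳ (Equiv.trans (Equiv.sym E.homomorphism) (E.F-resp-≈ Equiv.refl)))))
              (proj₂ (agree p) (over x) (proj₁ (agree p)) Equiv.refl)) }
      ; identity = Equiv.trans (E.F-resp-≈ Equiv.refl) E.identity
      ; homomorphism = Equiv.trans (E.F-resp-≈ Equiv.refl) E.homomorphism
      ; F-resp-≈ = E.F-resp-≈
      }

    ∃/⊣fresh/ : ∃/ ⊣ fresh/ Ξ
    ∃/⊣fresh/ = record
      { unit = record
        { η = λ (A , x) → unit/ x , unit/-cell x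
        ; natural = λ { {A , x} {B , y} (f , p) →
            Equiv.trans (NatTrans.natural adj.unit (mor {x = x} {y} f p))
                        (∘-resp-≈ˡ (K.F-resp-≈ (E.F-resp-≈ Equiv.refl))) }
        }
      ; counit = record
        { η = λ (A , ξ) → counit/ A , At.refl
        ; natural = λ { {A , _} {B , _} (f , p) → let open HomReasoning in begin
            (ε B ∘ E.F₁ (id , _)) ∘ E.F₁ (K.F₁ f , _)  ≈⟨ assoc ⟩
            ε B ∘ E.F₁ (id , _) ∘ E.F₁ (K.F₁ f , _)    ≈⟨ ∘-resp-≈ʳ E.homomorphism ⟨
            ε B ∘ E.F₁ (id ∘ K.F₁ f , _)
              ≈⟨ ∘-resp-≈ʳ (E.F-resp-≈ (Equiv.trans identityˡ (Equiv.sym identityʳ))) ⟩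
            ε B ∘ E.F₁ (K.F₁ f ∘ id , _)               ≈⟨ ∘-resp-≈ʳ E.homomorphism ⟩
            ε B ∘ E.F₁ (F₁ fresh f) ∘ E.F₁ (id , _)    ≈⟨ assoc ⟨
            (ε B ∘ E.F₁ (F₁ fresh f)) ∘ E.F₁ (id , _)  ≈⟨ ∘-resp-≈ˡ (NatTrans.natural adj.counit f) ⟩
            (f ∘ ε A) ∘ E.F₁ (id , _)                  ≈⟨ assoc ⟩
            f ∘ ε A ∘ E.F₁ (id , _)                    ∎ }
        }
      ; zig = λ (A , x) → let open HomReasoning in begin
          (ε _ ∘ E.F₁ (id , _)) ∘ E.F₁ (unit/ x , _)  ≈⟨ assoc ⟩
          ε _ ∘ E.F₁ (id , _) ∘ E.F₁ (unit/ x , _)    ≈⟨ ∘-resp-≈ʳ E.homomorphism ⟨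
          ε _ ∘ E.F₁ (id ∘ unit/ x , _)               ≈⟨ ∘-resp-≈ʳ (E.F-resp-≈ identityˡ) ⟩
          ε _ ∘ E.F₁ (η adj.unit (A , over x))        ≈⟨ adj.zig (A , over x) ⟩
          id                                          ∎
      ; zag = λ _ → transpose-unit (id , Equiv.refl)
      } where
      unit/ : ∀ {A} (x : Presheaf.Elt (Ξ ⋉y) A) → A ⇒ K.F₀ (E.F₀ (A , over x))
      unit/ {A} x = proj₁ (η adj.unit (A , over x))

      counit/ : ∀ A → E.F₀ (K.F₀ A , π₂ ∘ id) ⇒ A
      counit/ A = ε A ∘ E.F₁ (id , Equiv.refl)

      transpose-unit : ∀ {A B} {u : A ⇒ U} (f : Category._⇒_ (Slice W U) (A , u) (F₀ fresh B)) →
                       K.F₁ (ε B ∘ E.F₁ f) ∘ proj₁ (η adj.unit (A , u)) ≈ proj₁ f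
      transpose-unit {A} {B} {u} f = let open HomReasoning in begin
        K.F₁ (ε B ∘ E.F₁ f) ∘ proj₁ (η adj.unit (A , u))
          ≈⟨ ∘-resp-≈ˡ K.homomorphism ⟩
        (K.F₁ (ε B) ∘ K.F₁ (E.F₁ f)) ∘ proj₁ (η adj.unit (A , u))
          ≈⟨ assoc ⟩
        K.F₁ (ε B) ∘ K.F₁ (E.F₁ f) ∘ proj₁ (η adj.unit (A , u))
          ≈⟨ ∘-resp-≈ʳ (NatTrans.natural adj.unit f) ⟨
        K.F₁ (ε B) ∘ proj₁ (η adj.unit (F₀ fresh B)) ∘ proj₁ f
          ≈⟨ assoc ⟨
        (K.F₁ (ε B) ∘ proj₁ (η adj.unit (F₀ fresh B))) ∘ proj₁ f
          ≈⟨ ∘-resp-≈ˡ (adj.zag B) ⟩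
        id ∘ proj₁ f
          ≈⟨ identityˡ ⟩
        proj₁ f ∎

      unit/-cell : ∀ {A} (x : Presheaf.Elt (Ξ ⋉y) A) →
                   Presheaf._·_ (Ξ ⋉y) (⋉cell Ξ (element x)) (unit/ x) ≋ x
      unit/-cell (cell {B} f ξ) = Eq.return
        (slide (ε B ∘ E.F₁ (f , Equiv.refl))
          (Equiv.trans (∘-resp-≈ʳ identityˡ) (transpose-unit (f , Equiv.refl)))
          At.refl)

    ∃ᴾ : Functor (Psh (∫ (Ξ ⋉y))) (Psh (∫ Ξ))
    ∃ᴾ = Lan ∃/

-- Fᴾ, ∀ᴾ and Tᴾ need no left adjoint of the fresh weakening functor.

record Triple {W : Category ℓ ℓ ℓ} {T : Terminal W} {U : Category.Obj W}
              (M : Multiplier T U) (Ξ : Presheaf W) : Set (lsuc ℓ) where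
  field
    F⊣∀ : Fᴾ M Ξ ⊣ ∀ᴾ M Ξ
    ∀⊣T : ∀ᴾ M Ξ ⊣ Tᴾ M Ξ

  const : NatTrans idF (∀ᴾ M Ξ ∘F Fᴾ M Ξ)
  const = unit F⊣∀

  app : NatTrans (Fᴾ M Ξ ∘F ∀ᴾ M Ξ) idF
  app = counit F⊣∀

  reidx : NatTrans idF (Tᴾ M Ξ ∘F ∀ᴾ M Ξ)
  reidx = unit ∀⊣T

  unmerid : NatTrans (∀ᴾ M Ξ ∘F Tᴾ M Ξ) idF
  unmerid = counit ∀⊣T

record Quadruple {W : Category ℓ ℓ ℓ} {T : Terminal W} {U : Category.Obj W}
                 (M : Multiplier T U) (S : TopSliceRightAdjoint M) (Ξ : Presheaf W)
       : Set (lsuc ℓ) where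
  field
    triple : Triple M Ξ
    ∃⊣F    : ∃ᴾ M S Ξ ⊣ Fᴾ M Ξ
    F≅     : Fᴾ M Ξ ≅ precomp (∃/ M S Ξ)
    ∀≅     : ∀ᴾ M Ξ ≅ Ran (∃/ M S Ξ)

  open Triple triple public

  copy : NatTrans idF (Fᴾ M Ξ ∘F ∃ᴾ M S Ξ)
  copy = unit ∃⊣F

  drop : NatTrans (∃ᴾ M S Ξ ∘F Fᴾ M Ξ) idF
  drop = counit ∃⊣F

record ShapeSystem {W : Category o ℓ e} (T : Terminal W) (s : Level)
       : Set (o ⊔ ℓ ⊔ e ⊔ lsuc s) where
  field
    Shape : Set s
    obj   : Shape → Category.Obj W
    mult  : (𝕌 : Shape) → Multiplier T (obj 𝕌)

module _ {W : Category ℓ ℓ ℓ} {T : Terminal W} (𝒮 : ShapeSystem T s) where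
  open ShapeSystem 𝒮

  -- Variable names are immaterial, so only their shapes are recorded.
  infixl 5 _▷_

  data ShapeCtx : Set s where
    ∙   : ShapeCtx
    _▷_ : ShapeCtx → Shape → ShapeCtx

  ⟦_⟧ : ShapeCtx → Presheaf W
  ⟦ ∙ ⟧     = ⊤ᴾ
  ⟦ X ▷ 𝕌 ⟧ = _⋉y (mult 𝕌) ⟦ X ⟧

  ModeCat : ShapeCtx → Category (lsuc ℓ) ℓ ℓ
  ModeCat X = Psh (∫ ⟦ X ⟧)

module _ {W : Category ℓ ℓ ℓ} {T : Terminal W} {𝒮 : ShapeSystem T s} where

  record Modality (X₁ X₂ : ShapeCtx 𝒮) : Set (lsuc ℓ) where
    constructor modality
    field
      {lock} : Functor (ModeCat 𝒮 X₂) (ModeCat 𝒮 X₁)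
      {sem}  : Functor (ModeCat 𝒮 X₁) (ModeCat 𝒮 X₂)
      adj    : lock ⊣ sem

  open Modality

  private
    variable
      X Y Z V : ShapeCtx 𝒮

  1ᴹ : Modality X X
  1ᴹ = modality id⊣id

  infixr 9 _∘ᴹ_

  _∘ᴹ_ : Modality Y Z → Modality X Y → Modality X Z
  ν ∘ᴹ μ = modality (adj μ ∘⊣ adj ν)

  infix 4 _⇒₂_ _≈₂_

  record _⇒₂_ (μ ν : Modality X Y) : Set (lsuc ℓ) where
    constructor named
    field
      leftName : NatTrans (lock ν) (lock μ)

  open _⇒₂_

  _≈₂_ : {μ ν : Modality X Y} → Rel (μ ⇒₂ ν) (lsuc ℓ)
  α ≈₂ β = leftName α ≃ leftName β

  ⟦_⟧₂ : {μ ν : Modality X Y} → μ ⇒₂ ν → NatTrans (sem μ) (sem ν)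
  ⟦_⟧₂ {μ = μ} {ν = ν} β = mate (adj μ) (adj ν) (leftName β)

  id₂ : {μ : Modality X Y} → μ ⇒₂ μ
  id₂ = named (Category.id (Functors _ _))

  infixr 9 _∙₂_

  _∙₂_ : {μ ν ρ : Modality X Y} → ν ⇒₂ ρ → μ ⇒₂ ν → μ ⇒₂ ρ
  γ ∙₂ β = named (Category._∘_ (Functors _ _) (leftName β) (leftName γ))

  -- Locks compose contravariantly, so the two whiskerings trade places.
  infixr 10 _◃_
  infixl 10 _▹_

  _◃_ : {μ μ′ : Modality X Y} (ν : Modality Y Z) → μ ⇒₂ μ′ → ν ∘ᴹ μ ⇒₂ ν ∘ᴹ μ′
  ν ◃ β = named (leftName β ▸ lock ν)

  _▹_ : {ν ν′ : Modality Y Z} → ν ⇒₂ ν′ → (μ : Modality X Y) → ν ∘ᴹ μ ⇒₂ ν′ ∘ᴹ μ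
  β ▹ μ = named (lock μ ◂ β .leftName)

  module _ (μ : Modality X Y) where

    unitˡ→ : 1ᴹ ∘ᴹ μ ⇒₂ μ
    unitˡ→ = named ρ←

    unitˡ← : μ ⇒₂ 1ᴹ ∘ᴹ μ
    unitˡ← = named ρ→

    unitʳ→ : μ ∘ᴹ 1ᴹ ⇒₂ μ
    unitʳ→ = named λ←

    unitʳ← : μ ⇒₂ μ ∘ᴹ 1ᴹ
    unitʳ← = named λ→

  module _ (ρ : Modality Z V) (ν : Modality Y Z) (μ : Modality X Y) where

    assoc→ : (ρ ∘ᴹ ν) ∘ᴹ μ ⇒₂ ρ ∘ᴹ (ν ∘ᴹ μ)
    assoc→ = named α→

    assoc← : ρ ∘ᴹ (ν ∘ᴹ μ) ⇒₂ (ρ ∘ᴹ ν) ∘ᴹ μ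
    assoc← = named α←

  infix 4 _⊣ᴹ_

  record _⊣ᴹ_ (μ : Modality X Y) (ν : Modality Y X) : Set (lsuc ℓ) where
    field
      unitᴹ   : 1ᴹ ⇒₂ ν ∘ᴹ μ
      counitᴹ : μ ∘ᴹ ν ⇒₂ 1ᴹ
      zigᴹ    : unitˡ→ μ ∙₂ counitᴹ ▹ μ ∙₂ assoc← μ ν μ ∙₂ μ ◃ unitᴹ ∙₂ unitʳ← μ ≈₂ id₂
      zagᴹ    : unitʳ→ ν ∙₂ ν ◃ counitᴹ ∙₂ assoc→ ν μ ν ∙₂ unitᴹ ▹ ν ∙₂ unitˡ← ν ≈₂ id₂

module _ {W : Category ℓ ℓ ℓ} {T : Terminal W} (𝒮 : ShapeSystem T s)
         (X : ShapeCtx 𝒮) (𝕌 : ShapeSystem.Shape 𝒮) where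
  open ShapeSystem 𝒮
  open Modality
  open _⇒₂_

  private
    Ξ = ⟦_⟧ 𝒮 X
    M = mult 𝕌

  record InternalTriple (t : Triple M Ξ) : Set (lsuc ℓ) where
    open Triple t

    ∀ᵤ : Modality {𝒮 = 𝒮} (X ▷ 𝕌) X
    ∀ᵤ = modality F⊣∀

    tᵤ : Modality {𝒮 = 𝒮} X (X ▷ 𝕌)
    tᵤ = modality ∀⊣T

    field
      lock-∀ : lock ∀ᵤ ≡ Fᴾ M Ξ
      sem-∀  : sem ∀ᵤ ≡ ∀ᴾ M Ξ
      lock-t : lock tᵤ ≡ ∀ᴾ M Ξ
      sem-t  : sem tᵤ ≡ Tᴾ M Ξ
      ∀⊣t    : ∀ᵤ ⊣ᴹ tᵤ

    reidxᵤ : 1ᴹ ⇒₂ tᵤ ∘ᴹ ∀ᵤ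
    reidxᵤ = _⊣ᴹ_.unitᴹ ∀⊣t

    unmeridᵤ : ∀ᵤ ∘ᴹ tᵤ ⇒₂ 1ᴹ
    unmeridᵤ = _⊣ᴹ_.counitᴹ ∀⊣t

    field
      reidx-leftName   : leftName reidxᵤ ≃ app
      reidx-sem        : ⟦ reidxᵤ ⟧₂ ≃ reidx
      unmerid-leftName : leftName unmeridᵤ ≃ const
      unmerid-sem      : ⟦ unmeridᵤ ⟧₂ ≃ unmerid

  record InternalQuadruple (S : TopSliceRightAdjoint M) (q : Quadruple M S Ξ)
         : Set (lsuc ℓ) where
    open Quadruple q
    field
      internalTriple : InternalTriple triple

    open InternalTriple internalTriple public

    fᵤ : Modality {𝒮 = 𝒮} X (X ▷ 𝕌)
    fᵤ = modality ∃⊣F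

    field
      lock-f : lock fᵤ ≡ ∃ᴾ M S Ξ
      sem-f  : sem fᵤ ≡ Fᴾ M Ξ
      f⊣∀    : fᵤ ⊣ᴹ ∀ᵤ

    constᵤ : 1ᴹ ⇒₂ ∀ᵤ ∘ᴹ fᵤ
    constᵤ = _⊣ᴹ_.unitᴹ f⊣∀

    appᵤ : fᵤ ∘ᴹ ∀ᵤ ⇒₂ 1ᴹ
    appᵤ = _⊣ᴹ_.counitᴹ f⊣∀

    field
      const-leftName : leftName constᵤ ≃ drop
      const-sem      : ⟦ constᵤ ⟧₂ ≃ const
      app-leftName   : leftName appᵤ ≃ copy
      app-sem        : ⟦ appᵤ ⟧₂ ≃ app

{-# OPTIONS --safe #-}
module Submission where

open import Level using (Level)
open import Data.Product using (_×_; _,_)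
open import Function.Bundles using (Func)
open import Relation.Binary.Bundles using (Setoid)
import Relation.Binary.Construct.Closure.Equivalence as Eq
open import Relation.Binary.PropositionalEquality using (refl)
open import Defs

-- For any functor K there are adjunctions Lan K ⊣ K* ⊣ Ran K between presheaf
-- categories.  If moreover L ⊣ R, then L* ⊣ R*, concretely L* ≅ Lan R and
-- R* ≅ Ran L.  With R the fresh weakening functor on categories of elements and
-- L its left adjoint this is the quadruple.  Two consecutive adjunctions
-- A ⊣ B ⊣ C are modalities with locks A and B; the unit and counit of the first
-- are left names for the 2-cells which exhibit these modalities as adjoint, and
-- the mates of these names are the unit and counit of B ⊣ C.

open Functor using (F₀; F₁)
open NatTrans using (η)
open _⊣_ using (unit; counit)

private
  variable
    o ℓ e o′ ℓ′ e′ s : Level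

-- Isomorphisms and adjunctions in general

Iso-sym : {C : Category o ℓ e} {A B : Category.Obj C} → Iso C A B → Iso C B A
Iso-sym i = record { to = from ; from = to ; isoˡ = isoʳ ; isoʳ = isoˡ }
  where open Iso i

≃-refl : {C : Category o ℓ e} {D : Category o′ ℓ′ e′} {F G : Functor C D}
         (α : NatTrans F G) → α ≃ α
≃-refl {D = D} α X = Category.Equiv.refl D

-- The isomorphism is absorbed into the unit and its inverse into the counit; the two cancel in each
-- triangle. This lets `Fᴾ`, defined as a left Kan extension, replace precomposition with `∃/` as
-- the right adjoint of `∃ᴾ`.
⊣-resp-≅ʳ : {C : Category o ℓ e} {D : Category o′ ℓ′ e′}
            {L : Functor C D} {R R′ : Functor D C} → L ⊣ R → R ≅ R′ → L ⊣ R′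
⊣-resp-≅ʳ {C = C} {D} {L} {R} {R′} a i = record
  { unit = record
    { η = λ A → η i.to (L.F₀ A) C.∘ η a.unit A
    ; natural = λ {X} {Y} f → let open C in let open C.HomReasoning in begin
        (η i.to (L.F₀ Y) ∘ η a.unit Y) ∘ f
          ≈⟨ assoc ⟩
        η i.to (L.F₀ Y) ∘ η a.unit Y ∘ f
          ≈⟨ ∘-resp-≈ʳ (NatTrans.natural a.unit f) ⟩
        η i.to (L.F₀ Y) ∘ R.F₁ (L.F₁ f) ∘ η a.unit X
          ≈⟨ assoc ⟨
        (η i.to (L.F₀ Y) ∘ R.F₁ (L.F₁ f)) ∘ η a.unit X
          ≈⟨ ∘-resp-≈ˡ (NatTrans.natural i.to (L.F₁ f)) ⟩
        (R′.F₁ (L.F₁ f) ∘ η i.to (L.F₀ X)) ∘ η a.unit X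
          ≈⟨ assoc ⟩
        R′.F₁ (L.F₁ f) ∘ η i.to (L.F₀ X) ∘ η a.unit X ∎
    }
  ; counit = record
    { η = λ B → η a.counit B D.∘ L.F₁ (η i.from B)
    ; natural = λ {X} {Y} f → let open D in let open D.HomReasoning in begin
        (η a.counit Y ∘ L.F₁ (η i.from Y)) ∘ L.F₁ (R′.F₁ f)
          ≈⟨ assoc ⟩
        η a.counit Y ∘ L.F₁ (η i.from Y) ∘ L.F₁ (R′.F₁ f)
          ≈⟨ ∘-resp-≈ʳ L.homomorphism ⟨
        η a.counit Y ∘ L.F₁ (η i.from Y C.∘ R′.F₁ f)
          ≈⟨ ∘-resp-≈ʳ (L.F-resp-≈ (NatTrans.natural i.from f)) ⟩
        η a.counit Y ∘ L.F₁ (R.F₁ f C.∘ η i.from X)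
          ≈⟨ ∘-resp-≈ʳ L.homomorphism ⟩
        η a.counit Y ∘ L.F₁ (R.F₁ f) ∘ L.F₁ (η i.from X)
          ≈⟨ assoc ⟨
        (η a.counit Y ∘ L.F₁ (R.F₁ f)) ∘ L.F₁ (η i.from X)
          ≈⟨ ∘-resp-≈ˡ (NatTrans.natural a.counit f) ⟩
        (f ∘ η a.counit X) ∘ L.F₁ (η i.from X)
          ≈⟨ assoc ⟩
        f ∘ η a.counit X ∘ L.F₁ (η i.from X) ∎
    }
  ; zig = λ A → let open D in let open D.HomReasoning in begin
      (η a.counit (L.F₀ A) ∘ L.F₁ (η i.from (L.F₀ A))) ∘ L.F₁ (η i.to (L.F₀ A) C.∘ η a.unit A)
        ≈⟨ assoc ⟩
      η a.counit (L.F₀ A) ∘ L.F₁ (η i.from (L.F₀ A)) ∘ L.F₁ (η i.to (L.F₀ A) C.∘ η a.unit A)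
        ≈⟨ ∘-resp-≈ʳ L.homomorphism ⟨
      η a.counit (L.F₀ A) ∘ L.F₁ (η i.from (L.F₀ A) C.∘ η i.to (L.F₀ A) C.∘ η a.unit A)
        ≈⟨ ∘-resp-≈ʳ (L.F-resp-≈ (C.Equiv.trans (C.Equiv.sym C.assoc)
             (C.Equiv.trans (C.∘-resp-≈ˡ (i.isoˡ (L.F₀ A))) C.identityˡ))) ⟩
      η a.counit (L.F₀ A) ∘ L.F₁ (η a.unit A)
        ≈⟨ a.zig A ⟩
      id ∎
  ; zag = λ B → let open C in let open C.HomReasoning in begin
      R′.F₁ (η a.counit B D.∘ L.F₁ (η i.from B)) ∘ η i.to (L.F₀ (R′.F₀ B)) ∘ η a.unit (R′.F₀ B)
        ≈⟨ assoc ⟨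
      (R′.F₁ (η a.counit B D.∘ L.F₁ (η i.from B)) ∘ η i.to (L.F₀ (R′.F₀ B))) ∘ η a.unit (R′.F₀ B)
        -- Naturality moves `i.to` to the far left; further down, naturality of the unit moves
        -- `i.from` to the far right, and the triangle of `a` appears between them.
        ≈⟨ ∘-resp-≈ˡ (NatTrans.natural i.to _) ⟨
      (η i.to B ∘ R.F₁ (η a.counit B D.∘ L.F₁ (η i.from B))) ∘ η a.unit (R′.F₀ B)
        ≈⟨ ∘-resp-≈ˡ (∘-resp-≈ʳ R.homomorphism) ⟩
      (η i.to B ∘ R.F₁ (η a.counit B) ∘ R.F₁ (L.F₁ (η i.from B))) ∘ η a.unit (R′.F₀ B)
        ≈⟨ assoc ⟩
      η i.to B ∘ (R.F₁ (η a.counit B) ∘ R.F₁ (L.F₁ (η i.from B))) ∘ η a.unit (R′.F₀ B)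
        ≈⟨ ∘-resp-≈ʳ assoc ⟩
      η i.to B ∘ R.F₁ (η a.counit B) ∘ R.F₁ (L.F₁ (η i.from B)) ∘ η a.unit (R′.F₀ B)
        ≈⟨ ∘-resp-≈ʳ (∘-resp-≈ʳ (NatTrans.natural a.unit (η i.from B))) ⟨
      η i.to B ∘ R.F₁ (η a.counit B) ∘ η a.unit (R.F₀ B) ∘ η i.from B
        ≈⟨ ∘-resp-≈ʳ assoc ⟨
      η i.to B ∘ (R.F₁ (η a.counit B) ∘ η a.unit (R.F₀ B)) ∘ η i.from B
        ≈⟨ ∘-resp-≈ʳ (∘-resp-≈ˡ (a.zag B)) ⟩
      η i.to B ∘ id ∘ η i.from B
        ≈⟨ ∘-resp-≈ʳ identityˡ ⟩
      η i.to B ∘ η i.from B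
        ≈⟨ i.isoʳ B ⟩
      id ∎
  } where
  module C = Category C
  module D = Category D
  module L = Functor L
  module R = Functor R
  module R′ = Functor R′
  module a = _⊣_ a
  module i = Iso i

-- Kan extensions along an arbitrary functor

module _ {C D : Category ℓ ℓ ℓ} (K : Functor C D) where
  private
    module C = Category C
    module D = Category D
    module K = Functor K

  -- The coend relation is generated by slides alone, so even cells with equal components are
  -- related only through a slide along the identity.
  cell-cong : (P : Presheaf C) {d : D.Obj} {a : C.Obj} {f g : d D.⇒ K.F₀ a}
              {x y : Presheaf.Elt P a} → f D.≈ g → Presheaf.At._≈_ P x y →
              Setoid._≈_ (F₀ (F₀ (Lan K) P) d) (cell f x) (cell g y)
  cell-cong P p q = Eq.return
    (slide C.id (D.Equiv.trans (D.∘-resp-≈ˡ K.identity) (D.Equiv.trans D.identityˡ p))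
      (Presheaf.At.trans P q (Presheaf.At.sym P (Presheaf.·-id P))))

  -- Every `cell f x` is the restriction along `f` of `cell id x`, so a map out of the coend is
  -- fixed by its values on the latter. Hence the unit inserts an identity arrow and the counit
  -- carries out the formal restriction `x · f`.
  Lan⊣precomp : Lan K ⊣ precomp K
  Lan⊣precomp = record
    { unit = record
      { η = λ P → record
        { η = λ A → record
          { to = cell D.id
          ; cong = cell-cong P D.Equiv.refl
          }
        -- Naturality of the unit is the coend relation for `h`.
        ; natural = λ h x → Eq.return
            (slide h (D.Equiv.trans D.identityʳ (D.Equiv.sym D.identityˡ)) (Presheaf.At.refl P))
        }
      ; natural = λ {_} {Q} α A x → cell-cong Q D.Equiv.refl (Presheaf.At.refl Q)
      }
    ; counit = record
      { η = λ Q → record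
        { η = λ d → record
          { to = evaluate Q
          ; cong = evaluate-cong Q
          }
        ; natural = λ { g (cell f x) → Presheaf.·-∘ Q }
        }
      ; natural = λ { {_} {Q} β d (cell f x) → Presheaf.At.sym Q (NatTrans.natural β f x) }
      }
    ; zig = λ { P d (cell f x) → cell-cong P D.identityˡ (Presheaf.At.refl P) }
    ; zag = λ Q A x → Presheaf.·-id Q
    } where
    evaluate : ∀ (Q : Presheaf D) {d} → Cell K (F₀ (precomp K) Q) d → Presheaf.Elt Q d
    evaluate Q (cell f x) = Presheaf._·_ Q x f

    evaluate-cong : ∀ (Q : Presheaf D) {d} {x y : Cell K (F₀ (precomp K) Q) d} →
                    Setoid._≈_ (F₀ (F₀ (Lan K) (F₀ (precomp K) Q)) d) x y →
                    Presheaf.At._≈_ Q (evaluate Q x) (evaluate Q y)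
    -- Equality in `Q` is an equivalence relation, so a single slide suffices; there the claim is
    -- functoriality of `Q`.
    evaluate-cong Q = Eq.gfold At.isEquivalence (evaluate Q)
      λ { (slide h p q) → At.trans (·-congˡ q) (At.trans (At.sym ·-∘) (·-congʳ p)) }
      where open Presheaf Q

  -- The Yoneda argument: the unit turns an element `y` into the transformation of all its
  -- restrictions, and the counit evaluates a transformation at the identity.
  precomp⊣Ran : precomp K ⊣ Ran K
  precomp⊣Ran = record
    { unit = record
      { η = λ Q → let open Presheaf Q in record
        { η = λ d → record
          { to = λ y → record
            { η = λ A → record { to = λ f → y · f ; cong = ·-congʳ }
            ; natural = λ h f → ·-∘
            }
          ; cong = λ p A f → ·-congˡ p
          }
        ; natural = λ g y A f → At.sym ·-∘
        }
      ; natural = λ {_} {Q} β d y A f → Presheaf.At.sym Q (NatTrans.natural β f y)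
      }
    ; counit = record
      { η = λ P → record
        { η = λ A → record
          { to = λ α → Func.to (η α A) D.id
          ; cong = λ p → p A D.id
          }
        ; natural = λ {A} {B} h α → Presheaf.At.trans P
            (Func.cong (η α B) (D.Equiv.trans D.identityʳ (D.Equiv.sym D.identityˡ)))
            (NatTrans.natural α h D.id)
        }
      ; natural = λ {_} {P} β A α → Presheaf.At.refl P
      }
    ; zig = λ Q A x → Presheaf.·-id Q
    ; zag = λ P d α A f → Func.cong (η α A) D.identityʳ
    }

-- Kan extensions along adjoint functors

module _ {C D : Category ℓ ℓ ℓ} {L : Functor D C} {R : Functor C D} (a : L ⊣ R) where
  private
    module C = Category C
    module D = Category D
    module L = Functor L
    module R = Functor R
    module a = _⊣_ a

    transpose : ∀ {d c} → d D.⇒ R.F₀ c → L.F₀ d C.⇒ c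
    transpose f = η a.counit _ C.∘ L.F₁ f

    transpose-∘ˡ : ∀ {d c c′} (h : c C.⇒ c′) (f : d D.⇒ R.F₀ c) →
                   h C.∘ transpose f C.≈ transpose (R.F₁ h D.∘ f)
    transpose-∘ˡ h f = let open C in let open HomReasoning in begin
      h ∘ η a.counit _ ∘ L.F₁ f              ≈⟨ assoc ⟨
      (h ∘ η a.counit _) ∘ L.F₁ f            ≈⟨ ∘-resp-≈ˡ (NatTrans.natural a.counit h) ⟨
      (η a.counit _ ∘ L.F₁ (R.F₁ h)) ∘ L.F₁ f ≈⟨ assoc ⟩
      η a.counit _ ∘ L.F₁ (R.F₁ h) ∘ L.F₁ f  ≈⟨ ∘-resp-≈ʳ L.homomorphism ⟨
      η a.counit _ ∘ L.F₁ (R.F₁ h D.∘ f)     ∎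

    transpose-∘ʳ : ∀ {d d′ c} (f : d D.⇒ R.F₀ c) (g : d′ D.⇒ d) →
                   transpose (f D.∘ g) C.≈ transpose f C.∘ L.F₁ g
    transpose-∘ʳ f g =
      C.Equiv.trans (C.∘-resp-≈ʳ L.homomorphism) (C.Equiv.sym C.assoc)

    transpose⁻¹ : ∀ {d c} → L.F₀ d C.⇒ c → d D.⇒ R.F₀ c
    transpose⁻¹ f = R.F₁ f D.∘ η a.unit _

    transpose⁻¹-transpose : ∀ {d c} (f : d D.⇒ R.F₀ c) → transpose⁻¹ (transpose f) D.≈ f
    transpose⁻¹-transpose f = let open D in let open HomReasoning in begin
      R.F₁ (η a.counit _ C.∘ L.F₁ f) ∘ η a.unit _        ≈⟨ ∘-resp-≈ˡ R.homomorphism ⟩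
      (R.F₁ (η a.counit _) ∘ R.F₁ (L.F₁ f)) ∘ η a.unit _ ≈⟨ assoc ⟩
      R.F₁ (η a.counit _) ∘ R.F₁ (L.F₁ f) ∘ η a.unit _   ≈⟨ ∘-resp-≈ʳ (NatTrans.natural a.unit f) ⟨
      R.F₁ (η a.counit _) ∘ η a.unit _ ∘ f               ≈⟨ assoc ⟨
      (R.F₁ (η a.counit _) ∘ η a.unit _) ∘ f             ≈⟨ ∘-resp-≈ˡ (a.zag _) ⟩
      id ∘ f                                             ≈⟨ identityˡ ⟩
      f                                                  ∎

    transpose-transpose⁻¹ : ∀ {d c} (f : L.F₀ d C.⇒ c) → transpose (transpose⁻¹ f) C.≈ f
    transpose-transpose⁻¹ f = let open C in let open HomReasoning in begin
      transpose (R.F₁ f D.∘ η a.unit _)        ≈⟨ transpose-∘ˡ f (η a.unit _) ⟨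
      f ∘ η a.counit _ ∘ L.F₁ (η a.unit _)     ≈⟨ ∘-resp-≈ʳ (a.zig _) ⟩
      f ∘ id                                   ≈⟨ identityʳ ⟩
      f                                        ∎

    transpose⁻¹-∘ˡ : ∀ {d c c′} (h : c C.⇒ c′) (f : L.F₀ d C.⇒ c) →
                     transpose⁻¹ (h C.∘ f) D.≈ R.F₁ h D.∘ transpose⁻¹ f
    transpose⁻¹-∘ˡ h f = D.Equiv.trans (D.∘-resp-≈ˡ R.homomorphism) D.assoc

    transpose⁻¹-∘ʳ : ∀ {d d′ c} (f : L.F₀ d C.⇒ c) (g : d′ D.⇒ d) →
                     transpose⁻¹ (f C.∘ L.F₁ g) D.≈ transpose⁻¹ f D.∘ g
    transpose⁻¹-∘ʳ f g = D.Equiv.trans (transpose⁻¹-∘ˡ f (L.F₁ g))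
      (D.Equiv.trans (D.∘-resp-≈ʳ (D.Equiv.sym (NatTrans.natural a.unit g))) (D.Equiv.sym D.assoc))

  -- Transposing turns the coend of `D(d , R c) × P c` into that of `C(L d , c) × P c`, which is
  -- `P (L d)` by the co-Yoneda lemma.
  Lan≅precomp : Lan R ≅ precomp L
  Lan≅precomp = record
    { to = record
      { η = λ P → record
        { η = λ d → record { to = contract P ; cong = contract-cong P }
        ; natural = λ { g (cell f x) → let open Presheaf P in
            At.trans (·-congʳ (transpose-∘ʳ f g)) ·-∘ }
        }
      ; natural = λ { {_} {Q} β d (cell f x) →
          Presheaf.At.sym Q (NatTrans.natural β (transpose f) x) }
      }
    ; from = record
      { η = λ P → let open Presheaf P in record
        { η = λ d → record
          { to = cell (η a.unit d)
          ; cong = cell-cong R P D.Equiv.refl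
          }
        ; natural = λ g x → Eq.return
            (slide (L.F₁ g) (D.Equiv.sym (NatTrans.natural a.unit g)) At.refl)
        }
      ; natural = λ {_} {Q} β d x → cell-cong R Q D.Equiv.refl (Presheaf.At.refl Q)
      }
    -- Since `f` is the unit followed by `R` of its transpose, sliding along the transpose recovers
    -- the original cell.
    ; isoˡ = λ { P d (cell f x) → Eq.return
        (slide (transpose f) (transpose⁻¹-transpose f) (Presheaf.At.refl P)) }
    ; isoʳ = λ P d x → let open Presheaf P in At.trans (·-congʳ (a.zig d)) ·-id
    } where
    contract : ∀ (P : Presheaf C) {d} → Cell R P d → Presheaf.Elt P (L.F₀ d)
    contract P (cell f x) = Presheaf._·_ P x (transpose f)

    contract-cong : ∀ (P : Presheaf C) {d} {x y : Cell R P d} →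
                    Setoid._≈_ (F₀ (F₀ (Lan R) P) d) x y →
                    Presheaf.At._≈_ P (contract P x) (contract P y)
    contract-cong P = Eq.gfold At.isEquivalence (contract P)
      -- Transposition is natural in the codomain, hence compatible with slides.
      λ { (slide h {f} p q) → At.trans (·-congˡ q) (At.trans (At.sym ·-∘)
            (·-congʳ (C.Equiv.trans (transpose-∘ˡ h f) (C.∘-resp-≈ʳ (L.F-resp-≈ p))))) }
      where open Presheaf P

  -- The presheaf `C(L - , c)` is represented by `R c` with universal element the counit at `c`. By
  -- Yoneda, transformations from it to `Q` are the elements of `Q (R c)`, read off at the counit.
  precomp≅Ran : precomp R ≅ Ran L
  precomp≅Ran = record
    { to = record
      { η = λ Q → let open Presheaf Q in record
        { η = λ c → record
          { to = λ x → record
            { η = λ d → record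
              { to = λ f → x · transpose⁻¹ f
              ; cong = λ p → ·-congʳ (D.∘-resp-≈ˡ (R.F-resp-≈ p))
              }
            ; natural = λ g f → At.trans (·-congʳ (transpose⁻¹-∘ʳ f g)) ·-∘
            }
          ; cong = λ p d f → ·-congˡ p
          }
        ; natural = λ h x d f → At.trans (At.sym ·-∘) (·-congʳ (D.Equiv.sym (transpose⁻¹-∘ˡ h f)))
        }
      ; natural = λ {_} {Q} β c x d f →
          Presheaf.At.sym Q (NatTrans.natural β (transpose⁻¹ f) x)
      }
    ; from = record
      { η = λ Q → record
        { η = λ c → record
          { to = λ α → Func.to (η α (R.F₀ c)) (η a.counit c)
          ; cong = λ p → p (R.F₀ c) (η a.counit c)
          }
        ; natural = λ {c} {c′} h α → Presheaf.At.trans Q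
            (Func.cong (η α (R.F₀ c′)) (C.Equiv.sym (NatTrans.natural a.counit h)))
            (NatTrans.natural α (R.F₁ h) (η a.counit c))
        }
      ; natural = λ {_} {Q} β c α → Presheaf.At.refl Q
      }
    ; isoˡ = λ Q c x → let open Presheaf Q in At.trans (·-congʳ (a.zag c)) ·-id
    -- Each `f` is the counit restricted along `transpose⁻¹ f`, so naturality of `α` determines its
    -- value at `f`.
    ; isoʳ = λ Q c α d f → Presheaf.At.trans Q
        (Presheaf.At.sym Q (NatTrans.natural α (transpose⁻¹ f) (η a.counit c)))
        (Func.cong (η α d) (transpose-transpose⁻¹ f))
    }

-- Mates of units and counits

-- The unitors and the associator in `mate` have identity components and drop out.
mate-component : {C : Category o ℓ e} {D : Category o′ ℓ′ e′} {L L′ : Functor C D}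
                 {R R′ : Functor D C} (a : L ⊣ R) (a′ : L′ ⊣ R′) (β : NatTrans L′ L) →
                 let open Category C in ∀ B →
                 η (mate a a′ β) B
                   ≈ F₁ R′ (η (counit a) B) ∘ F₁ R′ (η β (F₀ R B)) ∘ η (unit a′) (F₀ R B)
mate-component {C = C} a a′ β B =
  trans identityˡ (∘-resp-≈ʳ (∘-resp-≈ʳ (trans identityˡ identityʳ)))
  where
  open Category C
  open Equiv

module _ {C : Category o ℓ e} {D : Category o′ ℓ′ e′}
         {L R : Functor C D} {M : Functor D C} (a : L ⊣ M) (b : M ⊣ R) where
  private
    module C = Category C
    module D = Category D
    module R = Functor R
    module M = Functor M
    module a = _⊣_ a
    module b = _⊣_ b

  -- The composite adjunction contributes `a.unit` under `R`, which meets the given `a.counit`; the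
  -- triangle `a.zag` cancels the pair and leaves `b.unit`.
  mate-counit : mate id⊣id (a ∘⊣ b) a.counit ≃ b.unit
  mate-counit A = let open D in let open HomReasoning in begin
    η (mate id⊣id (a ∘⊣ b) a.counit) A
      ≈⟨ mate-component id⊣id (a ∘⊣ b) a.counit A ⟩
    R.F₁ (M.F₁ id) ∘ R.F₁ (M.F₁ (η a.counit A)) ∘ R.F₁ (η a.unit (M.F₀ A)) ∘ η b.unit A
      ≈⟨ ∘-resp-≈ˡ (Equiv.trans (R.F-resp-≈ M.identity) R.identity) ⟩
    id ∘ R.F₁ (M.F₁ (η a.counit A)) ∘ R.F₁ (η a.unit (M.F₀ A)) ∘ η b.unit A
      ≈⟨ identityˡ ⟩
    R.F₁ (M.F₁ (η a.counit A)) ∘ R.F₁ (η a.unit (M.F₀ A)) ∘ η b.unit A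
      ≈⟨ assoc ⟨
    (R.F₁ (M.F₁ (η a.counit A)) ∘ R.F₁ (η a.unit (M.F₀ A))) ∘ η b.unit A
      ≈⟨ ∘-resp-≈ˡ R.homomorphism ⟨
    R.F₁ (M.F₁ (η a.counit A) C.∘ η a.unit (M.F₀ A)) ∘ η b.unit A
      ≈⟨ ∘-resp-≈ˡ (Equiv.trans (R.F-resp-≈ (a.zag A)) R.identity) ⟩
    id ∘ η b.unit A
      ≈⟨ identityˡ ⟩
    η b.unit A ∎

  -- Dually, the counit of the composite contains `a.counit`; the same triangle `a.zag` cancels it
  -- against `a.unit`.
  mate-unit : mate (b ∘⊣ a) id⊣id a.unit ≃ b.counit
  mate-unit A = let open C in let open HomReasoning in begin
    η (mate (b ∘⊣ a) id⊣id a.unit) A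
      ≈⟨ mate-component (b ∘⊣ a) id⊣id a.unit A ⟩
    (η b.counit A ∘ M.F₁ (η a.counit (R.F₀ A))) ∘ η a.unit (M.F₀ (R.F₀ A)) ∘ id
      ≈⟨ ∘-resp-≈ʳ identityʳ ⟩
    (η b.counit A ∘ M.F₁ (η a.counit (R.F₀ A))) ∘ η a.unit (M.F₀ (R.F₀ A))
      ≈⟨ assoc ⟩
    η b.counit A ∘ M.F₁ (η a.counit (R.F₀ A)) ∘ η a.unit (M.F₀ (R.F₀ A))
      ≈⟨ ∘-resp-≈ʳ (a.zag (R.F₀ A)) ⟩
    η b.counit A ∘ id
      ≈⟨ identityʳ ⟩
    η b.counit A ∎

-- Adjoint modalities from adjoint triples

module _ {W : Category ℓ ℓ ℓ} {T : Terminal W} {𝒮 : ShapeSystem T s} {X Y : ShapeCtx 𝒮}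
         {L R : Functor (ModeCat 𝒮 Y) (ModeCat 𝒮 X)} {M : Functor (ModeCat 𝒮 X) (ModeCat 𝒮 Y)}
         where

  ⊣⊣⇒⊣ᴹ : (a : L ⊣ M) (b : M ⊣ R) → modality {𝒮 = 𝒮} {X} {Y} a ⊣ᴹ modality b
  ⊣⊣⇒⊣ᴹ a b = record
    -- 2-cells run against their left names, so the counit names the unit and conversely.
    { unitᴹ   = named (counit a)
    ; counitᴹ = named (unit a)
    -- Coherence cells act on elements as identity functions and compute away. Composition and
    -- whiskering are both reversed on left names, so zig remains zig.
    ; zigᴹ    = _⊣_.zig a
    ; zagᴹ    = _⊣_.zag a
    }

-- The adjoint functors of a multiplier

module _ {W : Category ℓ ℓ ℓ} {T : Terminal W} {U : Category.Obj W}
         (M : Multiplier T U) (Ξ : Presheaf W) where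

  triple : Triple M Ξ
  triple = record
    { F⊣∀ = Lan⊣precomp (fresh/ M Ξ)
    ; ∀⊣T = precomp⊣Ran (fresh/ M Ξ)
    }

  quadruple : (S : TopSliceRightAdjoint M) → Quadruple M S Ξ
  quadruple S = record
    { triple = triple
    ; ∃⊣F    = ⊣-resp-≅ʳ (Lan⊣precomp (∃/ M S Ξ)) (Iso-sym (Lan≅precomp (∃/⊣fresh/ M S Ξ)))
    ; F≅     = Lan≅precomp (∃/⊣fresh/ M S Ξ)
    ; ∀≅     = precomp≅Ran (∃/⊣fresh/ M S Ξ)
    }

-- Internalization as modalities

module _ {W : Category ℓ ℓ ℓ} {T : Terminal W} (𝒮 : ShapeSystem T s)
         (X : ShapeCtx 𝒮) (𝕌 : ShapeSystem.Shape 𝒮) where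
  open ShapeSystem 𝒮

  internalTriple : (t : Triple (mult 𝕌) (⟦_⟧ 𝒮 X)) → InternalTriple 𝒮 X 𝕌 t
  internalTriple t = record
    { lock-∀           = refl
    ; sem-∀            = refl
    ; lock-t           = refl
    ; sem-t            = refl
    ; ∀⊣t              = ⊣⊣⇒⊣ᴹ F⊣∀ ∀⊣T
    ; reidx-leftName   = ≃-refl app
    -- The left name `app` is the counit of `F⊣∀`; its mate is the unit of the next adjunction.
    ; reidx-sem        = mate-counit F⊣∀ ∀⊣T
    ; unmerid-leftName = ≃-refl const
    ; unmerid-sem      = mate-unit F⊣∀ ∀⊣T
    }
    where open Triple t

  internalQuadruple : (S : TopSliceRightAdjoint (mult 𝕌)) (q : Quadruple (mult 𝕌) S (⟦_⟧ 𝒮 X)) →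
                      InternalQuadruple 𝒮 X 𝕌 S q
  internalQuadruple S q = record
    { internalTriple = internalTriple (Quadruple.triple q)
    ; lock-f         = refl
    ; sem-f          = refl
    -- The same pattern as for `∀⊣t`, moved one adjunction to the left.
    ; f⊣∀            = ⊣⊣⇒⊣ᴹ ∃⊣F F⊣∀
    ; const-leftName = ≃-refl drop
    ; const-sem      = mate-counit ∃⊣F F⊣∀
    ; app-leftName   = ≃-refl copy
    ; app-sem        = mate-unit ∃⊣F F⊣∀
    }
    where open Quadruple q

theorem6p29 : ∀ {ℓ s} (W : Category ℓ ℓ ℓ) (T : Terminal W) →
    (∀ {U : Category.Obj W} (M : Multiplier T U) (Ξ : Presheaf W) →
    Triple M Ξ ×
    ((S : TopSliceRightAdjoint M) → Quadruple M S Ξ)) ×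
    (∀ (𝒮 : ShapeSystem T s) (X : ShapeCtx 𝒮) (𝕌 : ShapeSystem.Shape 𝒮) →
    ((t : Triple (ShapeSystem.mult 𝒮 𝕌) (⟦_⟧ 𝒮 X)) →
    InternalTriple 𝒮 X 𝕌 t) ×
    ((S : TopSliceRightAdjoint (ShapeSystem.mult 𝒮 𝕌))
    (q : Quadruple (ShapeSystem.mult 𝒮 𝕌) S (⟦_⟧ 𝒮 X)) →
    InternalQuadruple 𝒮 X 𝕌 S q))
theorem6p29 W T =
  (λ M Ξ → triple M Ξ , quadruple M Ξ) ,
  (λ 𝒮 X 𝕌 → internalTriple 𝒮 X 𝕌 , internalQuadruple 𝒮 X 𝕌)
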